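{- Let $G$ be a finite directed acyclic graph with a unique source $s$ and a unique sink $t$, with no idle edges, satisfying degree equality, and let $(\mathcal{R},\leq)$ be a route decomposition of $G$ with a linear ordering. If $G$ has an inner vertex with indegree at least $3$, then the equatorial flow triangulation $T_{\mathrm{eq}}\ast\Delta_{\mathcal{R}}$ of $\mathcal{F}_1(G)$ is not a DKK triangulation, i.e. it is not equal to the DKK triangulation of $\mathcal{F}_1(G)$ induced by any framing of $G$.
   Context: Directed graphs may have parallel edges. The vertices of $G$ are ordered $s<1<\cdots<n<t$ with every edge $(i,j)$ satisfying $i<j$; $1,\dots,n$ are the inner vertices. An edge is idle if it is the only incoming or the only outgoing edge of some inner vertex. A route is a directed path from $s$ to $t$ (a sequence of edges); $\chi_R\in\mathbb{R}^{E(G)}$ is the indicator vector of a route $R$. The flow polytope $\mathcal{F}_1(G)$ is the set of $x\in\mathbb{R}_{\ge 0}^{E(G)}$ with inflow equal to outflow at every inner vertex and total outflow $1$ at $s$; its vertices are the vectors $\chi_R$. Degree equality: $\mathrm{indeg}_G(v)=\mathrm{outdeg}_G(v)$ for all inner $v$. A route decomposition is a set $\mathcal{R}$ of routes whose edge sets partition $E(G)$. Framings and DKK triangulations. A framing is a choice, for each inner vertex $v$, of linear orders on the set $\mathrm{in}(v)$ of incoming edges and the set $\mathrm{out}(v)$ of outgoing edges. For a route $P$ through $v$, $Pv$ is the part of $P$ from $s$ to $v$ and $vP$ the part from $v$ to $t$. For two distinct directed paths $P,Q$ from $v$ to $t$, let $w$ be the last vertex of their common initial segment starting at $v$; then $P\prec_{\mathrm{Out}(v)}Q$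 if the edge of $P$ leaving $w$ is smaller in $\mathrm{out}(w)$ than the edge of $Q$ leaving $w$. Symmetrically, for two distinct directed paths $P,Q$ from $s$ to $v$, let $w$ be the first vertex of their common final segment ending at $v$; then $P\prec_{\mathrm{In}(v)}Q$ if the edge of $P$ entering $w$ is smaller in $\mathrm{in}(w)$ than the edge of $Q$ entering $w$. Two routes $P,Q$ sharing an inner vertex $v$ are in conflict at $v$ if (up to exchanging $P$ and $Q$) $Pv\prec_{\mathrm{In}(v)}Qv$ and $vQ\prec_{\mathrm{Out}(v)}vP$. Two routes are coherent if they are not in conflict at any common inner vertex. A clique is a set of pairwise coherent routes. The DKK triangulation of $\mathcal{F}_1(G)$ induced by a framing is the triangulation whose simplices are the convex hulls of $\{\chi_R: R\in C\}$ for cliques $C$ (it is a regular unimodular triangulation by a theorem of Danilov, Karzanov and Koshevoy). Equatorial flow triangulation. Given $\mathcal{R}=\{R_1<\cdots<R_k\}$, the route decomposition framing orders the incoming edges, and likewise the outgoing edges, at each inner vertex by the order of the (unique) routes of $\mathcal{R}$ containing them; let $T$ be the induced DKK triangulation. Let $\Gamma$ be the polyhedral subcomplex of $\partial\mathcal{F}_1(G)$ generated by all faces of the form $\bigcap_{R\in\mathcal{R}}F_R$, where each $F_R$ is a facet of $\mathcal{F}_1(G)$ with $\chi_R\notin F_R$; $T_{\mathrm{eq}}:=T|_\Gamma$ is the subcomplex of simplices of $T$ contained in a face of $\Gamma$. Let $\Delta_{\mathcal{R}}=\mathrm{conv}\{\chi_R:R\in\mathcal{R}\}$. The equatorial flow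 triangulation is the join $T_{\mathrm{eq}}\ast\Delta_{\mathcal{R}}$, i.e. the triangulation of $\mathcal{F}_1(G)$ generated by the simplices $\mathrm{conv}(F\cup\Delta_{\mathcal{R}})$ for $F$ a face of $T_{\mathrm{eq}}$. -}

module Defs where

open import Level using (0ℓ; _⊔_) renaming (suc to lsuc)
open import Algebra.Apartness.Bundles using (HeytingCommutativeRing; HeytingField)
open import Algebra.Bundles using (CommutativeRing)
import Algebra.Definitions.RawMonoid as RawMonoidSum
open import Axiom.UniquenessOfIdentityProofs using (module Decidable⇒UIP)
open import Data.Bool.Base using (if_then_else_)
open import Data.Empty using (⊥-elim)
open import Data.Fin.Base as Fin using (Fin; zero; suc; fromℕ; inject₁)
import Data.Fin.Properties as Finₚ
open import Data.List.Base using (List; []; _∷_; _++_; length; lookup; filter; allFin; tabulate)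
import Data.List.Membership.DecPropositional as DecMembership
open import Data.List.Membership.Propositional using (_∈_)
open import Data.List.Relation.Binary.Subset.Propositional using () renaming (_⊆_ to _⊆ᴸ_)
open import Data.List.Relation.Unary.AllPairs using (AllPairs)
open import Data.List.Relation.Unary.Any using (here; there)
open import Data.Nat.Base using (ℕ; suc)
import Data.Nat.Properties as ℕₚ
open import Data.Product.Base using (Σ; ∃; ∃-syntax; _×_; _,_; proj₁; proj₂)
open import Data.Sum.Base using (_⊎_)
open import Function.Base using (_on_)
open import Function.Definitions using (Injective)
open import Relation.Binary.Core using (Rel)
open import Relation.Binary.Definitions using (Trichotomous; tri<; tri≈; tri>)
open import Relation.Binary.PropositionalEquality
  using (_≡_; refl; sym; trans; cong; subst; isEquivalence; resp₂)
open import Relation.Binary.Structures using (IsStrictPartialOrder; IsStrictTotalOrder)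
open import Relation.Nullary.Decidable.Core using (does)
open import Relation.Nullary.Negation.Core using (¬_)
open import Relation.Unary using (Pred; _≐_; _⊆_)

-- The scalars.  The standard library has no real numbers, so polytopes are
-- taken over an arbitrary ordered field.  Classically a model of this record is
-- exactly an ordered field (in particular ℝ is one).  The order is not required
-- to be decidable, so constructive Cauchy or Dedekind reals are models as well.
-- Non-triviality (0 # 1) follows from the Heyting field laws.
record OrderedField c ℓ₁ ℓ₂ ℓ₃ : Set (lsuc (c ⊔ ℓ₁ ⊔ ℓ₂ ⊔ ℓ₃)) where
  field
    heytingField : HeytingField c ℓ₁ ℓ₂
  open HeytingField heytingField public
  infix 4 _<_ _≤_
  field
    _<_                  : Rel Carrier ℓ₃
    isStrictPartialOrder : IsStrictPartialOrder _≈_ _<_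
    #⇒<⊎>                : ∀ {x y} → x # y → x < y ⊎ y < x
    <⇒#                  : ∀ {x y} → x < y → x # y
    +-monoˡ-<            : ∀ {x y} z → x < y → x + z < y + z
    *-pos                : ∀ {x y} → 0# < x → 0# < y → 0# < x * y

  _≤_ : Rel Carrier ℓ₃
  x ≤ y = ¬ (y < x)

  commutativeRing : CommutativeRing c ℓ₁
  commutativeRing = HeytingCommutativeRing.commutativeRing heytingCommutativeRing

  open RawMonoidSum (CommutativeRing.+-rawMonoid commutativeRing) public using (sum)

-- Edges are abstract labels, so parallel edges are allowed.  The vertices are
-- Fin (2 + inner#) in their given order s < 1 < ⋯ < n < t.
record Graph : Set where
  field
    inner# edge# : ℕ

  Vertex : Set
  Vertex = Fin (suc (suc inner#))

  Inner : Set
  Inner = Fin inner#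

  Edge : Set
  Edge = Fin edge#

  field
    src tgt : Edge → Vertex
    src<tgt : ∀ e → src e Fin.< tgt e

module Combinatorics (G : Graph) where
  open Graph G public

  s t : Vertex
  s = zero
  t = fromℕ (suc inner#)

  inner : Inner → Vertex
  inner v = suc (inject₁ v)

  indeg outdeg : Vertex → ℕ
  indeg  v = length (filter (λ e → tgt e Finₚ.≟ v) (allFin edge#))
  outdeg v = length (filter (λ e → src e Finₚ.≟ v) (allFin edge#))

  IsSource IsSink : Vertex → Set
  IsSource v = ∀ e → ¬ (tgt e ≡ v)
  IsSink   v = ∀ e → ¬ (src e ≡ v)

  UniqueSource UniqueSink : Set
  UniqueSource = IsSource s × (∀ v → IsSource v → v ≡ s)
  UniqueSink   = IsSink t × (∀ v → IsSink v → v ≡ t)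

  Idle : Edge → Set
  Idle e = ∃[ v ] ((tgt e ≡ inner v × (∀ f → tgt f ≡ inner v → f ≡ e))
                 ⊎ (src e ≡ inner v × (∀ f → src f ≡ inner v → f ≡ e)))

  NoIdleEdges : Set
  NoIdleEdges = ∀ e → ¬ Idle e

  DegreeEquality : Set
  DegreeEquality = ∀ v → indeg (inner v) ≡ outdeg (inner v)

  IsPath : Vertex → List Edge → Vertex → Set
  IsPath u []       w = u ≡ w
  IsPath u (e ∷ es) w = src e ≡ u × IsPath (tgt e) es w

  record Route : Set where
    field
      edges  : List Edge
      isPath : IsPath s edges t
  open Route public

  In Out : Inner → Set
  In  v = Σ Edge λ e → tgt e ≡ inner v
  Out v = Σ Edge λ e → src e ≡ inner v

  record Framing : Set₁ where
    field
      _<in_       : ∀ {v} → Rel (In v) 0ℓ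
      _<out_      : ∀ {v} → Rel (Out v) 0ℓ
      in-isOrder  : ∀ v → IsStrictTotalOrder {A = In v} _≡_ _<in_
      out-isOrder : ∀ v → IsStrictTotalOrder {A = Out v} _≡_ _<out_

  -- The linearly ordered set R₁ < ⋯ < Rₖ of routes is given by its increasing
  -- enumeration.  Routes are nonempty, so by ‘disjoint’ they are distinct.
  record RouteDecomposition : Set where
    field
      size     : ℕ
      route    : Fin size → Route
      cover    : ∀ e → ∃[ i ] e ∈ edges (route i)
      disjoint : ∀ {e i j} → e ∈ edges (route i) → e ∈ edges (route j) → i ≡ j

    routeOf : Edge → Fin size
    routeOf e = proj₁ (cover e)

  -- (p , q) is (Pv , vP) for a route P through the inner vertex v.
  Splits : Route → Inner → List Edge → List Edge → Set
  Splits P v p q = edges P ≡ p ++ q × IsPath s p (inner v) × IsPath (inner v) q t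

  module _ (𝔉 : Framing) where
    open Framing 𝔉

    -- e and f are the first edges after the common initial segment c: they
    -- differ because <out is irreflexive.
    _≺Out_ : Rel (List Edge) 0ℓ
    p ≺Out q = ∃[ w ] Σ (Out w) λ e → Σ (Out w) λ f → ∃[ c ] ∃[ p′ ] ∃[ q′ ]
      (p ≡ c ++ proj₁ e ∷ p′ × q ≡ c ++ proj₁ f ∷ q′ × e <out f)

    _≺In_ : Rel (List Edge) 0ℓ
    p ≺In q = ∃[ w ] Σ (In w) λ e → Σ (In w) λ f → ∃[ c ] ∃[ p′ ] ∃[ q′ ]
      (p ≡ p′ ++ proj₁ e ∷ c × q ≡ q′ ++ proj₁ f ∷ c × e <in f)

    Crosses : Inner → Rel Route 0ℓ
    Crosses v P Q = ∃[ Pv ] ∃[ vP ] ∃[ Qv ] ∃[ vQ ]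
      (Splits P v Pv vP × Splits Q v Qv vQ × Pv ≺In Qv × vQ ≺Out vP)

    Conflict : Inner → Rel Route 0ℓ
    Conflict v P Q = Crosses v P Q ⊎ Crosses v Q P

    Coherent : Rel Route 0ℓ
    Coherent P Q = ∀ v → ¬ Conflict v P Q

  -- A simplicial complex on the points χ_R is given by the vertex sets of its
  -- simplices; a finite set of routes is listed in any order, possibly with
  -- repetitions.  The simplices as subsets of space are the convex hulls below.
  Complex : ∀ ℓ → Set (lsuc ℓ)
  Complex ℓ = Pred (List Route) ℓ

  DKK : Framing → Complex 0ℓ
  DKK 𝔉 = AllPairs (Coherent 𝔉)

  private
    src≥ : ∀ {u w} es → IsPath u es w → ∀ {e} → e ∈ es → u Fin.≤ src e
    src≥ (_ ∷ es) (refl , p) (here refl) = ℕₚ.≤-refl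
    src≥ (d ∷ es) (refl , p) (there m)   =
      ℕₚ.≤-trans (ℕₚ.<⇒≤ (src<tgt d)) (src≥ es p m)

    src-injective : ∀ {u w} es → IsPath u es w →
                    ∀ {e f} → e ∈ es → f ∈ es → src e ≡ src f → e ≡ f
    src-injective (_ ∷ es) p (here refl) (here refl) _ = refl
    src-injective (d ∷ es) (_ , p) (here refl) (there n) eq =
      ⊥-elim (ℕₚ.<⇒≢ (ℕₚ.<-≤-trans (src<tgt d) (src≥ es p n)) (cong Fin.toℕ eq))
    src-injective (d ∷ es) (_ , p) (there m) (here refl) eq =
      ⊥-elim (ℕₚ.<⇒≢ (ℕₚ.<-≤-trans (src<tgt d) (src≥ es p m)) (cong Fin.toℕ (sym eq)))
    src-injective (_ ∷ es) (_ , p) (there m) (there n) eq = src-injective es p m n eq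

    tgt-injective : ∀ {u w} es → IsPath u es w →
                    ∀ {e f} → e ∈ es → f ∈ es → tgt e ≡ tgt f → e ≡ f
    tgt-injective (_ ∷ es) p (here refl) (here refl) _ = refl
    tgt-injective (d ∷ es) (_ , p) (here refl) (there n) eq =
      ⊥-elim (ℕₚ.<⇒≢ (ℕₚ.≤-<-trans (src≥ es p n) (src<tgt _)) (cong Fin.toℕ eq))
    tgt-injective (d ∷ es) (_ , p) (there m) (here refl) eq =
      ⊥-elim (ℕₚ.<⇒≢ (ℕₚ.≤-<-trans (src≥ es p m) (src<tgt _)) (cong Fin.toℕ (sym eq)))
    tgt-injective (_ ∷ es) (_ , p) (there m) (there n) eq = tgt-injective es p m n eq

    pullback-isOrder : ∀ {A : Set} {k} (f : A → Fin k) → Injective _≡_ _≡_ f →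
                       IsStrictTotalOrder _≡_ (Fin._<_ on f)
    pullback-isOrder f inj = record
      { isStrictPartialOrder = record
        { isEquivalence = isEquivalence
        ; irrefl        = λ { refl → Finₚ.<-irrefl refl }
        ; trans         = Finₚ.<-trans
        ; <-resp-≈      = resp₂ _
        }
      ; compare = cmp
      }
      where
      cmp : Trichotomous _≡_ (Fin._<_ on f)
      cmp a b with Finₚ.<-cmp (f a) (f b)
      ... | tri< lt ne gt = tri< lt (λ eq → ne (cong f eq)) gt
      ... | tri≈ lt eq gt = tri≈ lt (inj eq) gt
      ... | tri> lt ne gt = tri> lt (λ eq → ne (cong f eq)) gt

  module _ (𝓡 : RouteDecomposition) where
    open RouteDecomposition 𝓡

    private
      open Decidable⇒UIP (Finₚ._≟_ {suc (suc inner#)}) using (≡-irrelevant)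

      in-injective : ∀ v → Injective _≡_ _≡_ (λ (e : In v) → routeOf (proj₁ e))
      in-injective v {e , p} {f , q} eq
        with tgt-injective _ (isPath (route (routeOf f)))
               (subst (λ i → e ∈ edges (route i)) eq (proj₂ (cover e)))
               (proj₂ (cover f)) (trans p (sym q))
      ... | refl = cong (e ,_) (≡-irrelevant p q)

      out-injective : ∀ v → Injective _≡_ _≡_ (λ (e : Out v) → routeOf (proj₁ e))
      out-injective v {e , p} {f , q} eq
        with src-injective _ (isPath (route (routeOf f)))
               (subst (λ i → e ∈ edges (route i)) eq (proj₂ (cover e)))
               (proj₂ (cover f)) (trans p (sym q))
      ... | refl = cong (e ,_) (≡-irrelevant p q)

    routeDecompositionFraming : Framing
    routeDecompositionFraming = record
      { _<in_       = Fin._<_ on λ e → routeOf (proj₁ e)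
      ; _<out_      = Fin._<_ on λ e → routeOf (proj₁ e)
      ; in-isOrder  = λ v → pullback-isOrder _ (in-injective v)
      ; out-isOrder = λ v → pullback-isOrder _ (out-injective v)
      }

module Polytope {c ℓ₁ ℓ₂ ℓ₃} (K : OrderedField c ℓ₁ ℓ₂ ℓ₃) (G : Graph) where
  open OrderedField K using (Carrier; _≈_; _*_; 0#; 1#; _≤_; sum)
  open Combinatorics G
  open DecMembership (Finₚ._≟_ {edge#}) using (_∈?_)

  Point : Set c
  Point = Edge → Carrier

  inflow outflow : Vertex → Point → Carrier
  inflow  v x = sum λ e → if does (tgt e Finₚ.≟ v) then x e else 0#
  outflow v x = sum λ e → if does (src e Finₚ.≟ v) then x e else 0#

  FlowPolytope : Pred Point (ℓ₁ ⊔ ℓ₃)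
  FlowPolytope x = (∀ e → 0# ≤ x e)
                 × (∀ v → inflow (inner v) x ≈ outflow (inner v) x)
                 × outflow s x ≈ 1#

  χ : Route → Point
  χ R e = if does (e ∈? edges R) then 1# else 0#

  Conv : List Route → Pred Point (c ⊔ ℓ₁ ⊔ ℓ₃)
  Conv C x = Σ (Fin (length C) → Carrier) λ w →
    (∀ i → 0# ≤ w i) × sum w ≈ 1# × (∀ e → x e ≈ sum λ i → w i * χ (lookup C i) e)

  record Face : Set (c ⊔ ℓ₁ ⊔ ℓ₃) where
    field
      normal : Point
      bound  : Carrier

    value : Point → Carrier
    value x = sum λ e → normal e * x e

    field
      valid : ∀ {x} → FlowPolytope x → value x ≤ bound

    points : Pred Point (ℓ₁ ⊔ ℓ₃)
    points x = FlowPolytope x × value x ≈ bound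
  open Face public using (points)

  Proper : Face → Set (c ⊔ ℓ₁ ⊔ ℓ₃)
  Proper F = ¬ (FlowPolytope ⊆ points F)

  -- Facets are the inclusion-maximal proper faces.
  IsFacet : Face → Set (c ⊔ ℓ₁ ⊔ ℓ₃)
  IsFacet F = Proper F × (∀ F′ → Proper F′ → points F ⊆ points F′ → points F′ ⊆ points F)

  SameTriangulation : ∀ {a b} → Complex a → Complex b → Set (c ⊔ ℓ₁ ⊔ ℓ₃ ⊔ a ⊔ b)
  SameTriangulation A B =
      (∀ C → A C → ∃[ D ] (B D × Conv C ≐ Conv D))
    × (∀ D → B D → ∃[ C ] (A C × Conv C ≐ Conv D))

  module _ (𝓡 : RouteDecomposition) where
    open RouteDecomposition 𝓡

    -- A face belongs to the subcomplex Γ generated by the faces ⋂ F_R iff it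
    -- is contained in one of them (a face inside another face of the polytope is
    -- a face of it).
    record InΓ (Φ : Face) : Set (c ⊔ ℓ₁ ⊔ ℓ₃) where
      field
        facet   : Fin size → Face
        isFacet : ∀ i → IsFacet (facet i)
        avoids  : ∀ i → ¬ points (facet i) (χ (route i))
        below   : ∀ i → points Φ ⊆ points (facet i)

    T-eq : Complex (c ⊔ ℓ₁ ⊔ ℓ₃)
    T-eq C = DKK (routeDecompositionFraming 𝓡) C × (∃[ Φ ] (InΓ Φ × Conv C ⊆ points Φ))

    -- All faces of the simplices conv(F ∪ Δ_𝓡) with F a face of T-eq.
    equatorialFlowTriangulation : Complex (c ⊔ ℓ₁ ⊔ ℓ₃)
    equatorialFlowTriangulation S = ∃[ F ] (T-eq F × S ⊆ᴸ F ++ tabulate route)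

{-# OPTIONS --safe #-}

-- Every set F ∪ 𝓡 with F in T-eq spans a simplex, and each route P is a vertex
-- of such a simplex.  The vertices of a simplex are determined by its convex
-- hull, so if the triangulation is DKK for a framing 𝔉, then each route of 𝓡
-- is 𝔉-coherent with every route.  Let e₁ < e₂ < e₃ be edges entering v in the
-- order of 𝔉, lying on R₁, R₂, R₃ ∈ 𝓡.  Coherence of the Rᵢ gives f₁ < f₂ < f₃
-- for their edges fᵢ leaving v, so R₂ conflicts at v with R₁v followed by vR₃.
module Submission where

open import Defs
import Algebra.Apartness.Properties.HeytingCommutativeRing as HeytingProperties
open import Algebra.Bundles using (CommutativeRing)
import Algebra.Properties.Monoid.Sum as MonoidSum
import Algebra.Properties.Ring as RingProperties
open import Data.Bool.Base using (if_then_else_)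
open import Data.Empty using (⊥; ⊥-elim)
open import Data.Fin.Base as Fin using (Fin; zero; suc)
import Data.Fin.Properties as Finₚ
open import Data.List.Base using (List; []; _∷_; _++_; length; lookup; allFin; tabulate)
import Data.List.Membership.DecPropositional as DecMembership
open import Data.List.Membership.Propositional using (_∈_; _∉_; find)
open import Data.List.Membership.Propositional.Properties
  using (∈-++⁺ˡ; ∈-++⁺ʳ; ∈-lookup; ∈-tabulate⁺)
open import Data.List.Properties using (≡-dec)
open import Data.List.Relation.Unary.All as All using ([]; _∷_)
open import Data.List.Relation.Unary.All.Properties using (all-filter)
open import Data.List.Relation.Unary.AllPairs using (AllPairs; []; _∷_)
open import Data.List.Relation.Unary.Any as Any using (here; there)
open import Data.List.Relation.Unary.Unique.Propositional using (Unique)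
import Data.List.Relation.Unary.Unique.Propositional.Properties as Unique
open import Data.Nat.Base using (ℕ; _≤_; s≤s)
import Data.Nat.Properties as ℕₚ
open import Data.Product.Base using (∃-syntax; _×_; _,_; proj₁; proj₂)
open import Data.Sum.Base using (_⊎_; inj₁; inj₂; swap)
open import Function.Base using (_∘_; id)
open import Relation.Binary.Core using (Rel)
open import Relation.Binary.Definitions using (Symmetric; tri<; tri≈; tri>)
open import Relation.Binary.PropositionalEquality as ≡ using (_≡_; _≢_; cong; subst)
open import Relation.Binary.Structures using (IsStrictPartialOrder; IsStrictTotalOrder)
open import Relation.Nullary.Decidable.Core using (yes; no)
open import Relation.Nullary.Decidable using (dec-true; dec-false)
open import Relation.Nullary.Negation.Core using (¬_)

-- `AllPairs` relates an entry only to later ones. Symmetry covers the other order, and `x ≢ y`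
-- excludes that both memberships point to the same position.
AllPairs-lookup : ∀ {a ℓ} {A : Set a} {R : Rel A ℓ} → Symmetric R →
                  ∀ {xs x y} → AllPairs R xs → x ∈ xs → y ∈ xs → x ≢ y → R x y
AllPairs-lookup R-sym (r ∷ rs) (here ≡.refl) (here ≡.refl) x≢y = ⊥-elim (x≢y ≡.refl)
AllPairs-lookup R-sym (r ∷ rs) (here ≡.refl) (there y∈)    x≢y = All.lookup r y∈
AllPairs-lookup R-sym (r ∷ rs) (there x∈)    (here ≡.refl) x≢y = R-sym (All.lookup r x∈)
AllPairs-lookup R-sym (r ∷ rs) (there x∈)    (there y∈)    x≢y = AllPairs-lookup R-sym rs x∈ y∈ x≢y

-- Signs and finite sums in an ordered field

module Nonnegative {c ℓ₁ ℓ₂ ℓ₃} (K : OrderedField c ℓ₁ ℓ₂ ℓ₃) where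
  open OrderedField K hiding (zero) renaming (_≤_ to _≼_)
  open IsStrictPartialOrder isStrictPartialOrder
    using (<-respˡ-≈; <-respʳ-≈) renaming (trans to <-trans; irrefl to <-irrefl)
  open HeytingProperties heytingCommutativeRing using (1#0)
  open CommutativeRing commutativeRing using (ring; +-monoid)
  open RingProperties ring using (-1*x≈-x; -‿involutive; xyx⁻¹≈y)
  open MonoidSum +-monoid using (sum-cong-≋; sum-replicate-zero)

  0≼0 : 0# ≼ 0#
  0≼0 = <-irrefl refl

  -- If 1 < 0 then 0 < -1, and squaring -1 gives 0 < 1, a contradiction.
  0≼1 : 0# ≼ 1#
  0≼1 1<0 = <-irrefl refl (<-trans 0<1 1<0)
    where
    0<-1 : 0# < - 1#
    0<-1 = <-respˡ-≈ (-‿inverseʳ 1#) (<-respʳ-≈ (+-identityˡ (- 1#)) (+-monoˡ-< (- 1#) 1<0))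

    0<1 : 0# < 1#
    0<1 = <-respʳ-≈ (trans (-1*x≈-x (- 1#)) (-‿involutive 1#)) (*-pos 0<-1 0<-1)

  y<x+y : ∀ {x y} → 0# < x → y < x + y
  y<x+y {x} {y} 0<x = <-respˡ-≈ (+-identityˡ y) (+-monoˡ-< y 0<x)

  -- The sign of x cannot be decided. Cotransitivity applied to x + y # 0 gives x + y # x or x # 0,
  -- and in each resulting order x or y is negative.
  +-nonneg : ∀ {x y} → 0# ≼ x → 0# ≼ y → 0# ≼ x + y
  +-nonneg {x} {y} 0≼x 0≼y x+y<0 with #-cotrans (<⇒# x+y<0) x
  ... | inj₂ x#0 with #⇒<⊎> x#0
  ...   | inj₁ x<0 = 0≼x x<0
  ...   | inj₂ 0<x = 0≼y (<-trans (y<x+y 0<x) x+y<0)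
  +-nonneg {x} {y} 0≼x 0≼y x+y<0 | inj₁ x+y#x with #⇒<⊎> x+y#x
  ...   | inj₁ x+y<x = 0≼y (<-respˡ-≈ (xyx⁻¹≈y x y)
                             (<-respʳ-≈ (-‿inverseʳ x) (+-monoˡ-< (- x) x+y<x)))
  ...   | inj₂ x<x+y = 0≼x (<-trans x<x+y x+y<0)

  sum-nonneg : ∀ {n} (f : Fin n → Carrier) → (∀ i → 0# ≼ f i) → 0# ≼ sum f
  sum-nonneg {ℕ.zero}  f 0≼f = 0≼0
  sum-nonneg {ℕ.suc n} f 0≼f = +-nonneg (0≼f zero) (sum-nonneg (f ∘ suc) (0≼f ∘ suc))

  -- By tightness it suffices to refute x # 0, and 0 < x would give y < x + y = 0.
  x+y≈0⇒x≈0 : ∀ {x y} → 0# ≼ x → 0# ≼ y → x + y ≈ 0# → x ≈ 0#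
  x+y≈0⇒x≈0 {x} {y} 0≼x 0≼y eq = proj₁ (tight x 0#) λ x#0 → case-# (#⇒<⊎> x#0)
    where
    case-# : ¬ (x < 0# ⊎ 0# < x)
    case-# (inj₁ x<0) = 0≼x x<0
    case-# (inj₂ 0<x) = 0≼y (<-respʳ-≈ eq (y<x+y 0<x))

  sum≈0⇒≈0 : ∀ {n} (f : Fin n → Carrier) → (∀ i → 0# ≼ f i) → sum f ≈ 0# → ∀ i → f i ≈ 0#
  sum≈0⇒≈0 f 0≼f eq zero    = x+y≈0⇒x≈0 (0≼f zero) (sum-nonneg (f ∘ suc) (0≼f ∘ suc)) eq
  sum≈0⇒≈0 f 0≼f eq (suc i) = sum≈0⇒≈0 (f ∘ suc) (0≼f ∘ suc)
    (x+y≈0⇒x≈0 (sum-nonneg (f ∘ suc) (0≼f ∘ suc)) (0≼f zero) (trans (+-comm _ _) eq)) i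

  sum-zero : ∀ {n} (f : Fin n → Carrier) → (∀ i → f i ≈ 0#) → sum f ≈ 0#
  sum-zero {n} f eq = trans (sum-cong-≋ eq) (sum-replicate-zero n)

  1≉0 : ¬ (1# ≈ 0#)
  1≉0 eq = #-irrefl eq 1#0

-- Paths and routes

module Routes (G : Graph) where
  open Combinatorics G

  IsPath-++ : ∀ {u v w} p {q} → IsPath u p v → IsPath v q w → IsPath u (p ++ q) w
  IsPath-++ []      ≡.refl   π′ = π′
  IsPath-++ (_ ∷ p) (eq , π) π′ = eq , IsPath-++ p π π′

  path-split : ∀ {u v w} es → IsPath u es w → ∀ {e} → e ∈ es → tgt e ≡ v →
               ∃[ p ] ∃[ q ] (es ≡ (p ++ e ∷ []) ++ q × IsPath u (p ++ e ∷ []) v × IsPath v q w)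
  path-split (e ∷ es) (eq , π) (here ≡.refl) ≡.refl = [] , es , ≡.refl , (eq , ≡.refl) , π
  path-split (d ∷ es) (eq , π) (there e∈) tgt≡
    with p , q , es≡ , π₁ , π₂ ← path-split es π e∈ tgt≡
    = d ∷ p , q , cong (d ∷_) es≡ , (eq , π₁) , π₂

  path-src≥ : ∀ {u w} es → IsPath u es w → ∀ {e} → e ∈ es → u Fin.≤ src e
  path-src≥ (_ ∷ es) (≡.refl , π) (here ≡.refl) = ℕₚ.≤-refl
  path-src≥ (d ∷ es) (≡.refl , π) (there e∈)    =
    ℕₚ.≤-trans (ℕₚ.<⇒≤ (src<tgt d)) (path-src≥ es π e∈)

  src<path-tail : ∀ {w e} es → IsPath (tgt e) es w → ∀ {f} → f ∈ es → src e Fin.< src f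
  src<path-tail {e = e} es π f∈ = ℕₚ.<-≤-trans (src<tgt e) (path-src≥ es π f∈)

  -- The witness f is the edge of q at the first place where the paths differ. Both leave the same
  -- vertex there, and sources increase along p, so p has no other edge starting at that vertex. The
  -- sink hypothesis prevents one path from stopping while the other goes on.
  paths-to-sink : ∀ {u w} → IsSink w → ∀ p q → IsPath u p w → IsPath u q w →
                  q ≡ p ⊎ ∃[ f ] (f ∈ q × f ∉ p)
  paths-to-sink sink []      []      _            _       = inj₁ ≡.refl
  paths-to-sink sink []      (f ∷ q) ≡.refl       (src≡ , _) = ⊥-elim (sink f src≡)
  paths-to-sink sink (e ∷ p) []      (src≡ , _)   ≡.refl  = ⊥-elim (sink e src≡)
  paths-to-sink sink (e ∷ p) (f ∷ q) (≡.refl , π) (src≡ , ρ) with f Finₚ.≟ e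
  ... | no f≢e = inj₂ (f , here ≡.refl , f∉)
    where
    f∉ : f ∉ e ∷ p
    f∉ (here f≡e) = f≢e f≡e
    f∉ (there f∈) = ℕₚ.<⇒≢ (src<path-tail p π f∈) (cong Fin.toℕ (≡.sym src≡))
  ... | yes ≡.refl with paths-to-sink sink p q π ρ
  ...   | inj₁ q≡p = inj₁ (cong (e ∷_) q≡p)
  ...   | inj₂ (g , g∈q , g∉p) = inj₂ (g , there g∈q , g∉)
    where
    g∉ : g ∉ e ∷ p
    g∉ (here ≡.refl) = ℕₚ.<-irrefl ≡.refl (src<path-tail q ρ g∈q)
    g∉ (there g∈)    = g∉p g∈

  inner-≢-sink : ∀ v → inner v ≢ t
  inner-≢-sink v eq = Finₚ.fromℕ≢inject₁ (≡.sym (Finₚ.suc-injective eq))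

  -- Exposes the edges of P on either side of v, so that a conflict at v follows from one comparison
  -- of incoming and one of outgoing edges.
  record Passage (P : Route) (v : Inner) (e : In v) (f : Out v) : Set where
    field
      pre post : List Edge
      splits   : Splits P v (pre ++ proj₁ e ∷ []) (proj₁ f ∷ post)

    in-∈ : proj₁ e ∈ edges P
    in-∈ = subst (proj₁ e ∈_) (≡.sym (proj₁ splits)) (∈-++⁺ˡ (∈-++⁺ʳ pre (here ≡.refl)))

    out-∈ : proj₁ f ∈ edges P
    out-∈ = subst (proj₁ f ∈_) (≡.sym (proj₁ splits)) (∈-++⁺ʳ (pre ++ proj₁ e ∷ []) (here ≡.refl))

  -- A route that enters v must leave it again, because an inner vertex is not the end `t`.
  passage : ∀ P {v} (e : In v) → proj₁ e ∈ edges P → ∃[ f ] Passage P v e f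
  passage P {v} (e , tgt≡) e∈ with path-split (edges P) (isPath P) e∈ tgt≡
  ... | p , []    , _       , _  , v≡t             = ⊥-elim (inner-≢-sink v v≡t)
  ... | p , f ∷ q , edges≡ , π₁ , π₂@(src≡ , _) =
    (f , src≡) , record { pre = p ; post = q ; splits = edges≡ , π₁ , π₂ }

  splice : ∀ {P Q v e f e′ f′} → Passage P v e f → Passage Q v e′ f′ → ∃[ R ] Passage R v e f′
  splice {e = e} {f′ = f′} ρ σ =
    record { edges = _ ; isPath = IsPath-++ (pre ρ ++ proj₁ e ∷ []) π₁ π₂ }
    , record { pre = pre ρ ; post = post σ ; splits = ≡.refl , π₁ , π₂ }
    where
    open Passage
    π₁ = proj₁ (proj₂ (splits ρ))
    π₂ = proj₂ (proj₂ (splits σ))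

  -- Conflicts between routes at a vertex

  module _ (𝔉 : Framing) where
    open Framing 𝔉

    passages-cross : ∀ {P Q v e f e′ f′} → Passage P v e f → Passage Q v e′ f′ →
                     e <in e′ → f′ <out f → Crosses 𝔉 v P Q
    passages-cross {v = v} ρ σ e<e′ f′<f =
      _ , _ , _ , _ , splits ρ , splits σ
      -- The common segments are empty: the paths already differ in their edges at v.
      , (v , _ , _ , [] , pre ρ , pre σ , ≡.refl , ≡.refl , e<e′)
      , (v , _ , _ , [] , post σ , post ρ , ≡.refl , ≡.refl , f′<f)
      where open Passage

    Coherent-sym : Symmetric (Coherent 𝔉)
    Coherent-sym coh v = coh v ∘ swap

    Crosses-resp : ∀ {P P′ Q Q′ v} → edges P ≡ edges P′ → edges Q ≡ edges Q′ →
                   Crosses 𝔉 v P Q → Crosses 𝔉 v P′ Q′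
    Crosses-resp P≡ Q≡ (_ , _ , _ , _ , (P-eq , P-paths) , (Q-eq , Q-paths) , orders) =
      _ , _ , _ , _
      , (≡.trans (≡.sym P≡) P-eq , P-paths) , (≡.trans (≡.sym Q≡) Q-eq , Q-paths) , orders

    -- Convex hulls identify a route only through its edge list, whereas a `Route` also carries a
    -- path proof. Coherence is therefore transported along equality of edge lists.
    Coherent-resp : ∀ {P P′ Q Q′} → edges P ≡ edges P′ → edges Q ≡ edges Q′ →
                    Coherent 𝔉 P Q → Coherent 𝔉 P′ Q′
    Coherent-resp {P} {P′} {Q} {Q′} P≡ Q≡ coh v (inj₁ x) =
      coh v (inj₁ (Crosses-resp {P′} {P} {Q′} {Q} (≡.sym P≡) (≡.sym Q≡) x))
    Coherent-resp {P} {P′} {Q} {Q′} P≡ Q≡ coh v (inj₂ x) =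
      coh v (inj₂ (Crosses-resp {Q′} {Q} {P′} {P} (≡.sym Q≡) (≡.sym P≡) x))

    module _ (𝓡 : RouteDecomposition) where
      open RouteDecomposition 𝓡

      no-increasing-triple :
        (∀ P i → edges P ≢ edges (route i) → Coherent 𝔉 P (route i)) →
        ∀ {v} {e₁ e₂ e₃ : In v} → e₁ <in e₂ → e₂ <in e₃ → ⊥
      no-increasing-triple exceptional {v} {e₁} {e₂} {e₃} e₁<e₂ e₂<e₃ =
        exceptional R₁₃ _ (different-routes {R₁₃} e₁≢e₂ ρ₁₃ ρ₂) v
          (inj₁ (passages-cross ρ₁₃ ρ₂ e₁<e₂ (out-mono (irrefl e₂<e₃) ρ₂ ρ₃ e₂<e₃)))
        where
        open Passage

        𝓡-in-order : IsStrictTotalOrder _≡_ (Framing._<in_ (routeDecompositionFraming 𝓡) {v})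
        𝓡-in-order = Framing.in-isOrder (routeDecompositionFraming 𝓡) v

        -- The order on `In v` compares the indices of routes, while its trichotomy speaks of
        -- equality of edges. Edges with the same route are comparable in neither direction and
        -- hence coincide.
        routeOf-≢ : ∀ {e f : In v} → e ≢ f → routeOf (proj₁ e) ≢ routeOf (proj₁ f)
        routeOf-≢ {e} {f} e≢f eq with IsStrictTotalOrder.compare 𝓡-in-order e f
        ... | tri< lt _ _ = Finₚ.<-irrefl eq lt
        ... | tri≈ _ e≡f _ = e≢f e≡f
        ... | tri> _ _ gt = Finₚ.<-irrefl (≡.sym eq) gt

        irrefl : ∀ {e f : In v} → e <in f → e ≢ f
        irrefl lt ≡.refl = IsStrictTotalOrder.irrefl (in-isOrder v) ≡.refl lt

        e₁≢e₂ = irrefl e₁<e₂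

        -- With equal edge lists, e would lie on the route of g as well as on its own, against
        -- disjointness. This supplies the inequality that `exceptional` asks for.
        different-routes : ∀ {P e f g h} → e ≢ g → Passage P v e f →
                           Passage (route (routeOf (proj₁ g))) v g h →
                           edges P ≢ edges (route (routeOf (proj₁ g)))
        different-routes e≢g ρ σ eq = routeOf-≢ e≢g
          (disjoint (proj₂ (cover _)) (subst (_ ∈_) eq (in-∈ ρ)))

        -- If f and h were equal, one edge would lie on two routes of the decomposition; if h came
        -- first, the two routes would be in conflict at v.
        out-mono : ∀ {e f g h} → e ≢ g →
                   Passage (route (routeOf (proj₁ e))) v e f →
                   Passage (route (routeOf (proj₁ g))) v g h → e <in g → f <out h
        out-mono {e} {f} {g} {h} e≢g ρ σ e<g
          with IsStrictTotalOrder.compare (out-isOrder v) f h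
        ... | tri< f<h _ _ = f<h
        ... | tri≈ _ ≡.refl _ = ⊥-elim (routeOf-≢ e≢g (disjoint (out-∈ ρ) (out-∈ σ)))
        ... | tri> _ _ h<f = ⊥-elim (exceptional R _ (different-routes {R} e≢g ρ σ) v
                                       (inj₁ (passages-cross ρ σ e<g h<f)))
          where R = route (routeOf (proj₁ e))

        through : (e : In v) → ∃[ f ] Passage (route (routeOf (proj₁ e))) v e f
        through e = passage _ e (proj₂ (cover (proj₁ e)))

        ρ₂  = proj₂ (through e₂)
        ρ₃  = proj₂ (through e₃)
        R₁₃ = proj₁ (splice (proj₂ (through e₁)) ρ₃)
        ρ₁₃ = proj₂ (splice (proj₂ (through e₁)) ρ₃)

  -- Three incoming edges in increasing order

  three-distinct-in : ∀ v → 3 ≤ indeg (inner v) →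
                      ∃[ e ] ∃[ f ] ∃[ g ] (_≢_ {A = In v} e f × e ≢ g × f ≢ g)
  three-distinct-in v = pick (Unique.filter⁺ into? (Unique.allFin⁺ edge#))
                             (all-filter into? (allFin edge#))
    where
    into? = λ e → tgt e Finₚ.≟ inner v

    pick : ∀ {es} → Unique es → All.All (λ e → tgt e ≡ inner v) es → 3 ≤ length es →
           ∃[ e ] ∃[ f ] ∃[ g ] (_≢_ {A = In v} e f × e ≢ g × f ≢ g)
    pick ((e≢f ∷ e≢g ∷ _) ∷ (f≢g ∷ _) ∷ _) (p ∷ q ∷ r ∷ _) (s≤s (s≤s (s≤s _))) =
      (_ , p) , (_ , q) , (_ , r) , e≢f ∘ cong proj₁ , e≢g ∘ cong proj₁ , f≢g ∘ cong proj₁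

distinct-triple⇒chain : ∀ {a ℓ} {A : Set a} {_<_ : Rel A ℓ} → IsStrictTotalOrder _≡_ _<_ →
                        ∀ {x y z} → x ≢ y → x ≢ z → y ≢ z →
                        ∃[ p ] ∃[ q ] ∃[ r ] (p < q × q < r)
distinct-triple⇒chain O {x} {y} {z} x≢y x≢z y≢z
  with IsStrictTotalOrder.compare O x y
     | IsStrictTotalOrder.compare O x z
     | IsStrictTotalOrder.compare O y z
... | tri≈ _ eq _ | _           | _           = ⊥-elim (x≢y eq)
... | _           | tri≈ _ eq _ | _           = ⊥-elim (x≢z eq)
... | _           | _           | tri≈ _ eq _ = ⊥-elim (y≢z eq)
... | tri< xy _ _ | _           | tri< yz _ _ = x , y , z , xy , yz
... | tri< xy _ _ | tri< xz _ _ | tri> _ _ zy = x , z , y , xz , zy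
... | tri< xy _ _ | tri> _ _ zx | tri> _ _ zy = z , x , y , zx , xy
... | tri> _ _ yx | tri< xz _ _ | tri< yz _ _ = y , x , z , yx , xz
... | tri> _ _ yx | tri> _ _ zx | tri< yz _ _ = y , z , x , yz , zx
... | tri> _ _ yx | _           | tri> _ _ zy = z , y , x , zy , yx

-- Routes as vertices of convex hulls

module Simplices {c ℓ₁ ℓ₂ ℓ₃} (K : OrderedField c ℓ₁ ℓ₂ ℓ₃) (G : Graph) where
  open OrderedField K hiding (zero) renaming (_≤_ to _≼_)
  open Nonnegative K
  open Combinatorics G
  open Polytope K G
  open Routes G
  open DecMembership (Finₚ._≟_ {edge#}) using (_∈?_)

  χ-∈ : ∀ R {e} → e ∈ edges R → χ R e ≡ 1#
  χ-∈ R {e} e∈ = cong (λ b → if b then 1# else 0#) (dec-true (e ∈? edges R) e∈)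

  χ-∉ : ∀ R {e} → e ∉ edges R → χ R e ≡ 0#
  χ-∉ R {e} e∉ = cong (λ b → if b then 1# else 0#) (dec-false (e ∈? edges R) e∉)

  vertex-∈-Conv : ∀ {P C} → P ∈ C → Conv C (χ P)
  vertex-∈-Conv {P} {.P ∷ C} (here ≡.refl) =
    w , w≥0 , trans (+-congˡ (sum-zero (w ∘ suc) λ _ → refl)) (+-identityʳ 1#) , λ e →
      sym (trans (+-cong (*-identityˡ (χ P e))
                         (sum-zero _ λ i → zeroˡ (χ (lookup C i) e))) (+-identityʳ (χ P e)))
    where
    w : _ → Carrier
    w zero    = 1#
    w (suc _) = 0#

    w≥0 : ∀ i → 0# ≼ w i
    w≥0 zero    = 0≼1
    w≥0 (suc _) = 0≼0
  vertex-∈-Conv {P} {Q ∷ C} (there P∈) with w , w≥0 , sum-w , comb ← vertex-∈-Conv P∈ =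
    w′ , w′≥0 , trans (+-identityˡ _) sum-w , λ e →
      trans (comb e) (sym (trans (+-congʳ (zeroˡ _)) (+-identityˡ _)))
    where
    w′ : _ → Carrier
    w′ zero    = 0#
    w′ (suc i) = w i

    w′≥0 : ∀ i → 0# ≼ w′ i
    w′≥0 zero    = 0≼0
    w′≥0 (suc i) = w≥0 i

  -- Since `χ R e` is 0 or 1, the product is x or 0, and no two weak inequalities have to be
  -- multiplied.
  term-nonneg : ∀ R e {x} → 0# ≼ x → 0# ≼ x * χ R e
  term-nonneg R e 0≼x x<0 with e ∈? edges R
  ... | yes _ = 0≼x (IsStrictPartialOrder.<-respˡ-≈ isStrictPartialOrder (*-identityʳ _) x<0)
  ... | no  _ = 0≼0 (IsStrictPartialOrder.<-respˡ-≈ isStrictPartialOrder (zeroʳ _) x<0)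

  -- A route other than P uses an edge outside P, at which χ P vanishes, so its
  -- weight in a convex combination equal to χ P is zero.
  vertex-extreme : IsSink t → ∀ {P D} → Conv D (χ P) → ∃[ P′ ] (P′ ∈ D × edges P′ ≡ edges P)
  vertex-extreme sink {P} {D} (w , w≥0 , sum-w , comb)
    with Any.any? (λ Q → ≡-dec Finₚ._≟_ (edges Q) (edges P)) D
  ... | yes found = find found
  ... | no ¬found = ⊥-elim (1≉0 (trans (sym sum-w) (sum-zero w w≈0)))
    where
    w≈0 : ∀ i → w i ≈ 0#
    w≈0 i with paths-to-sink sink (edges P) (edges (lookup D i)) (isPath P) (isPath (lookup D i))
    ... | inj₁ eq = ⊥-elim (¬found (Any.map (λ { ≡.refl → eq }) (∈-lookup {xs = D} i)))
    ... | inj₂ (e , e∈ , e∉) = begin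
      w i                    ≈⟨ *-identityʳ (w i) ⟨
      w i * 1#               ≡⟨ cong (w i *_) (χ-∈ (lookup D i) e∈) ⟨
      w i * χ (lookup D i) e ≈⟨ sum≈0⇒≈0 (λ j → w j * χ (lookup D j) e)
                                  (λ j → term-nonneg (lookup D j) e (w≥0 j))
                                  (trans (sym (comb e)) (reflexive (χ-∉ P e∉))) i ⟩
      0#                     ∎
      where
      open import Relation.Binary.Reasoning.Setoid (CommutativeRing.setoid commutativeRing)

  -- Comparison of the two triangulations

  module _ (𝓡 : RouteDecomposition) where
    open RouteDecomposition 𝓡

    decomposition-exceptional : IsSink t → ∀ 𝔉 →
      SameTriangulation (equatorialFlowTriangulation 𝓡) (DKK 𝔉) →
      ∀ P i → edges P ≢ edges (route i) → Coherent 𝔉 P (route i)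
    decomposition-exceptional sink 𝔉 (to , from) P i P≢
      -- The single route P is a clique. The equatorial simplex with the same hull places a copy of
      -- P in F ∪ 𝓡 for some F in `T-eq`.
      with C , (F , F∈ , C⊆) , C≐P ← from (P ∷ []) ([] ∷ [])
      with P₁ , P₁∈C , P₁≡ ← vertex-extreme sink {P} {C}
             (proj₂ C≐P (vertex-∈-Conv {P} {P ∷ []} (here ≡.refl)))
      -- The other direction is applied to all of F ∪ 𝓡 rather than to C, so that copies of both P
      -- and `route i` occur in one clique D.
      with D , clique , S≐D ← to (F ++ tabulate route) (F , F∈ , id)
      with P₂ , P₂∈D , P₂≡ ← vertex-extreme sink {P₁} {D}
             (proj₁ S≐D (vertex-∈-Conv (C⊆ P₁∈C)))
      with R , R∈D , R≡ ← vertex-extreme sink {route i} {D}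
             (proj₁ S≐D (vertex-∈-Conv (∈-++⁺ʳ F (∈-tabulate⁺ {f = route} i))))
      = Coherent-resp 𝔉 {P₂} {P} {R} {route i} P₂≡P R≡
          (AllPairs-lookup (λ {Q} {Q′} → Coherent-sym 𝔉 {Q} {Q′}) clique P₂∈D R∈D
            -- If both copies were the same entry of D, P and `route i` would have equal edge lists.
            λ { ≡.refl → P≢ (≡.trans (≡.sym P₂≡P) R≡) })
      where P₂≡P = ≡.trans P₂≡ P₁≡

theorem4p14 : ∀ {c ℓ₁ ℓ₂ ℓ₃} (K : OrderedField c ℓ₁ ℓ₂ ℓ₃) (G : Graph) →
    let open Combinatorics G
        open Polytope K G
    in
    UniqueSource → UniqueSink → NoIdleEdges → DegreeEquality →
    (𝓡 : RouteDecomposition) →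
    (∃[ v ] (3 ≤ indeg (inner v))) →
    (𝔉 : Framing) →
    ¬ SameTriangulation (equatorialFlowTriangulation 𝓡) (DKK 𝔉)
theorem4p14 K G _ (sink , _) _ _ 𝓡 (v , 3≤) 𝔉 same
  with e , f , g , e≢f , e≢g , f≢g ← Routes.three-distinct-in G v 3≤
  -- The edges are sorted by the order of `𝔉`, which may differ from the order of 𝓡.
  with _ , _ , _ , e₁<e₂ , e₂<e₃ ← distinct-triple⇒chain
         (Combinatorics.Framing.in-isOrder 𝔉 v) e≢f e≢g f≢g
  = Routes.no-increasing-triple G 𝔉 𝓡
      (Simplices.decomposition-exceptional K G 𝓡 sink 𝔉 same) e₁<e₂ e₂<e₃
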